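{- Let $Q$ be a well typed query and $P$ a well typed program such that an atom is selectable in $P$ whenever its input positions of non-variable type are filled with non-variable terms. Then every left-based derivation of $P\cup\{Q\}$ is an LD-derivation.
   Context: A query is a finite sequence of atoms; a clause is $h\leftarrow B$ with $h$ an atom and $B$ a query. Every predicate has a fixed mode, i.e. each argument position is either input or output; $p(\mathbf s,\mathbf t)$ denotes an atom with $\mathbf s$ (resp. $\mathbf t$) the vector of terms filling the input (resp. output) positions. In clause heads $p(\mathbf t_0,\mathbf s_{n+1})$, $\mathbf t_0$ is the input and $\mathbf s_{n+1}$ the output. Types. A type is a set of terms closed under instantiation. The variable type is the type of all terms; any other type is a non-variable type. Each argument position of each predicate has an associated type. $t:T$ means $t\in T$ (componentwise for vectors); $\models \varphi\Rightarrow \mathbf t:\mathbf T$ means that the implication holds after applying any substitution to all terms. Well typed. A query $p_1(\mathbf s_1,\mathbf t_1),\dots,p_n(\mathbf s_n,\mathbf t_n)$, with $p_i(\mathbf S_i,\mathbf T_i)$ the type of $p_i$, is well typed if for all $i\in\{1,\dots,n\}$, $\models(\bigwedge_{1\le j<i}\mathbf t_j:\mathbf T_j)\Rightarrow\mathbf s_i:\mathbf S_i$. A clause $p(\mathbf t_0,\mathbf s_{n+1})\leftarrow p_1(\mathbf s_1,\mathbf t_1),\dots,p_n(\mathbf s_n,\mathbf t_n)$, with $p(\mathbf T_0,\mathbf S_{n+1})$ the type of $p$, is well typed if for all $i\in\{1,\dots,n+1\}$, $\models(\bigwedge_{0\le j<i}\mathbf t_j:\mathbf T_j)\Rightarrow\mathbf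 s_i:\mathbf S_i$. A program is well typed if all its clauses are. Derivations. A program consists of clauses and, for each predicate $p/n$, a block declaration: a (possibly empty) set of atoms $p(b_1,\dots,b_n)$ with $b_i\in\{?,-\}$. An atom $p(t_1,\dots,t_n)$ is blocked if for some $p(b_1,\dots,b_n)$ in the declaration, $t_i$ is a variable for all $i$ with $b_i=-$; otherwise it is selectable. In a derivation step a query $Q_1,a,Q_2$ is replaced by $(Q_1,B,Q_2)\theta$, where $h\leftarrow B$ is a variant, renamed apart, of a program clause and $\theta$ is a most general unifier of the selected atom $a$ and $h$. A derivation of $P\cup\{Q\}$ is a (finite or infinite) sequence of such steps starting at $Q$. An LD-derivation always selects the leftmost atom. A delay-respecting derivation always selects a selectable atom. In a step, the atoms of $B\theta$ are direct descendants of $a$, and $b\theta$ is a direct descendant of $b$ for $b$ in $Q_1,Q_2$; "descendant" is the reflexive transitive closure. In a delay-respecting derivation, if $Q_i=R_1,R_2$ where $R_1$ contains no selectable atom, then every descendant of every atom in $R_1$ is waiting. A delay-respecting derivation is left-based if in each step $Q_i;Q_{i+1}$ the selected atom is waiting in $Q_i$ or is the leftmost selectable atom in $Q_i$. -}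

module Defs where

open import Level using (Level; suc)
open import Data.Nat.Base as ℕ using (ℕ; _+_; _≤_)
open import Data.Fin.Base as Fin using (Fin)
open import Data.List.Base as List using (List; []; _∷_; _++_; length)
open import Data.List.Membership.Propositional using (_∈_)
open import Data.List.Relation.Unary.All using (All)
open import Data.List.Relation.Unary.Any using (Any)
open import Data.Product.Base using (∃; ∃-syntax; _×_; _,_)
open import Data.Sum.Base using (_⊎_)
open import Data.Unit.Base using (⊤)
open import Data.Vec.Base as Vec using (Vec; []; _∷_)
import Data.Vec.Relation.Unary.Any as VecAny
open import Relation.Binary.Construct.Closure.ReflexiveTransitive using (Star)
open import Relation.Binary.PropositionalEquality using (_≡_)
open import Relation.Nullary.Negation.Core using (¬_)
open import Relation.Unary using (Pred)

data Mode : Set where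
  input output : Mode

record Language : Set₁ where
  field
    Function  : Set
    farity    : Function → ℕ
    Predicate : Set
    parity    : Predicate → ℕ
    mode      : (p : Predicate) → Fin (parity p) → Mode

data BlockMark : Set where
  ‵? ‵- : BlockMark

data Length : Set where
  finite : ℕ → Length
  ω      : Length

_<ˡ_ : ℕ → Length → Set
i <ˡ finite n = i ℕ.< n
i <ˡ ω        = ⊤

module Logic (L : Language) where
  open Language L

  Variable : Set
  Variable = ℕ

  data Term : Set where
    var : Variable → Term
    fun : (f : Function) → Vec Term (farity f) → Term

  IsVariable : Term → Set
  IsVariable t = ∃[ x ] t ≡ var x

  record Atom : Set where
    constructor atom
    field
      pred : Predicate
      args : Vec Term (parity pred)

    arg : Fin (parity pred) → Term
    arg = Vec.lookup args

  open Atom public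

  Query : Set
  Query = List Atom

  infix 5 _⟵_

  record Clause : Set where
    constructor _⟵_
    field
      head : Atom
      body : Query

  open Clause public

  record Substitution : Set where
    field
      apply         : Variable → Term
      finite-domain : ∃[ n ] (∀ x → n ≤ x → apply x ≡ var x)

  open Substitution public

  infixl 8 _[_] _[_]* _[_]ᵃ _[_]q _[_]ᶜ

  mutual
    _[_] : Term → Substitution → Term
    var x    [ σ ] = apply σ x
    fun f ts [ σ ] = fun f (ts [ σ ]*)

    _[_]* : ∀ {n} → Vec Term n → Substitution → Vec Term n
    []       [ σ ]* = []
    (t ∷ ts) [ σ ]* = t [ σ ] ∷ ts [ σ ]*

  _[_]ᵃ : Atom → Substitution → Atom
  atom p ts [ σ ]ᵃ = atom p (ts [ σ ]*)

  _[_]q : Query → Substitution → Query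
  Q [ σ ]q = List.map (_[ σ ]ᵃ) Q

  _[_]ᶜ : Clause → Substitution → Clause
  (h ⟵ B) [ σ ]ᶜ = h [ σ ]ᵃ ⟵ B [ σ ]q

  data _occursIn_ (x : Variable) : Term → Set where
    here  : x occursIn var x
    there : ∀ {f ts} → VecAny.Any (x occursIn_) ts → x occursIn fun f ts

  _occursInQuery_ : Variable → Query → Set
  x occursInQuery Q = Any (λ a → VecAny.Any (x occursIn_) (args a)) Q

  _occursInClause_ : Variable → Clause → Set
  x occursInClause (h ⟵ B) = x occursInQuery (h ∷ B)

  -- Two clauses are variants when each is an instance of the other.
  Variant : Clause → Clause → Set
  Variant c d = (∃[ σ ] d ≡ c [ σ ]ᶜ) × (∃[ τ ] c ≡ d [ τ ]ᶜ)

  RenamedApart : Clause → Query → Set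
  RenamedApart c Q = ∀ x → x occursInClause c → ¬ (x occursInQuery Q)

  Unifier : Atom → Atom → Substitution → Set
  Unifier a b θ = a [ θ ]ᵃ ≡ b [ θ ]ᵃ

  MostGeneralUnifier : Atom → Atom → Substitution → Set
  MostGeneralUnifier a b θ =
    Unifier a b θ ×
    (∀ σ → Unifier a b σ → ∃[ γ ] (∀ x → apply σ x ≡ apply θ x [ γ ]))

  record Type (ℓ : Level) : Set (suc ℓ) where
    field
      contains : Pred Term ℓ
      closed   : ∀ t σ → contains t → contains (t [ σ ])

  open Type public

  _∶_ : ∀ {ℓ} → Term → Type ℓ → Set ℓ
  t ∶ T = contains T t

  VariableType : ∀ {ℓ} → Type ℓ → Set ℓ
  VariableType T = ∀ t → t ∶ T

  NonVariableType : ∀ {ℓ} → Type ℓ → Set ℓ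
  NonVariableType T = ¬ VariableType T

  TypeAssignment : (ℓ : Level) → Set (suc ℓ)
  TypeAssignment ℓ = (p : Predicate) → Fin (parity p) → Type ℓ

  BlockDeclaration : Predicate → Set
  BlockDeclaration p = List (Vec BlockMark (parity p))

  record Program : Set where
    field
      clauses : List Clause
      block   : (p : Predicate) → BlockDeclaration p

  open Program public

  module _ {ℓ : Level} (τ : TypeAssignment ℓ) where

    -- The positions of mode m of the atom a are filled with terms of the
    -- types associated with them: s : S for m = input, t : T for m = output.
    Typed : Mode → Atom → Set ℓ
    Typed m a = ∀ k → mode (pred a) k ≡ m → arg a k ∶ τ (pred a) k

    WellTypedQuery : Query → Set ℓ
    WellTypedQuery Q =
      ∀ (i : Fin (length Q)) (σ : Substitution) →
      (∀ j → j Fin.< i → Typed output (List.lookup Q j [ σ ]ᵃ)) →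
      Typed input (List.lookup Q i [ σ ]ᵃ)

    -- t₀ is the input and sₙ₊₁ the output of the head; the first component
    -- is the condition for i ∈ {1,…,n}, the second the one for i = n+1.
    WellTypedClause : Clause → Set ℓ
    WellTypedClause (h ⟵ B) =
      (∀ (i : Fin (length B)) (σ : Substitution) →
       Typed input (h [ σ ]ᵃ) →
       (∀ j → j Fin.< i → Typed output (List.lookup B j [ σ ]ᵃ)) →
       Typed input (List.lookup B i [ σ ]ᵃ))
      ×
      (∀ (σ : Substitution) →
       Typed input (h [ σ ]ᵃ) →
       (∀ j → Typed output (List.lookup B j [ σ ]ᵃ)) →
       Typed output (h [ σ ]ᵃ))

    WellTypedProgram : Program → Set ℓ
    WellTypedProgram P = All WellTypedClause (clauses P)

    NonVariableInputsFilled : Atom → Set ℓ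
    NonVariableInputsFilled a =
      ∀ k → mode (pred a) k ≡ input → NonVariableType (τ (pred a) k) →
      ¬ IsVariable (arg a k)

  module _ (P : Program) where

    Blocked : Atom → Set
    Blocked a =
      ∃[ b ] b ∈ block P (pred a) ×
             (∀ k → Vec.lookup b k ≡ ‵- → IsVariable (arg a k))

    Selectable : Atom → Set
    Selectable a = ¬ Blocked a

    record Step (Q Q′ : Query) : Set where
      field
        left     : Query
        selected : Atom
        right    : Query
        query-≡  : Q ≡ left ++ selected ∷ right
        source   : Clause
        source-∈ : source ∈ clauses P
        clause   : Clause
        variant  : Variant source clause
        apart    : RenamedApart clause Q
        θ        : Substitution
        mgu      : MostGeneralUnifier selected (head clause) θ
        result-≡ : Q′ ≡ (left ++ body clause ++ right) [ θ ]q

      selectedPosition : ℕ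
      selectedPosition = length left

    LeftmostSelectable : ∀ {Q Q′} → Step Q Q′ → Set
    LeftmostSelectable s =
      Selectable (Step.selected s) × All (λ a → ¬ Selectable a) (Step.left s)

    -- Atom occurrences are identified by their position, counted from 0:
    -- the relation holds of k and k′ when the atom at position k′ of Q′ is
    -- a direct descendant of the atom at position k of Q.
    data StepDescendant {Q Q′} (s : Step Q Q′) : ℕ → ℕ → Set where
      from-left     : ∀ {m} → m ℕ.< length (Step.left s) →
                      StepDescendant s m m
      from-selected : ∀ {m} → m ℕ.< length (body (Step.clause s)) →
                      StepDescendant s (length (Step.left s))
                                       (length (Step.left s) + m)
      from-right    : ∀ {m} → m ℕ.< length (Step.right s) →
                      StepDescendant s
                        (length (Step.left s) + 1 + m)
                        (length (Step.left s) + length (body (Step.clause s)) + m)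

    -- A derivation with n steps consists of query 0, …, query n; the values
    -- of query beyond n are irrelevant.
    record Derivation (Q : Query) : Set where
      field
        steps : Length
        query : ℕ → Query
        start : query 0 ≡ Q
        step  : ∀ i → i <ˡ steps → Step (query i) (query (ℕ.suc i))

    module _ {Q : Query} (D : Derivation Q) where
      open Derivation D

      LDDerivation : Set
      LDDerivation = ∀ i (i< : i <ˡ steps) → Step.left (step i i<) ≡ []

      DelayRespecting : Set
      DelayRespecting = ∀ i (i< : i <ˡ steps) → Selectable (Step.selected (step i i<))

      -- The pair (i , k) stands for the atom at position k of query i.
      data DirectDescendant : ℕ × ℕ → ℕ × ℕ → Set where
        direct : ∀ {i k k′} (i< : i <ˡ steps) → StepDescendant (step i i<) k k′ →
                 DirectDescendant (i , k) (ℕ.suc i , k′)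

      Descendant : ℕ × ℕ → ℕ × ℕ → Set
      Descendant = Star DirectDescendant

      Waiting : ℕ → ℕ → Set
      Waiting i k =
        ∃[ j ] ∃[ R₁ ] ∃[ R₂ ]
          query j ≡ R₁ ++ R₂ ×
          All (λ a → ¬ Selectable a) R₁ ×
          (∃[ l ] l ℕ.< length R₁ × Descendant (j , l) (i , k))

      LeftBased : Set
      LeftBased =
        DelayRespecting ×
        (∀ i (i< : i <ˡ steps) →
         Waiting i (Step.selectedPosition (step i i<)) ⊎
         LeftmostSelectable (step i i<))

{-# OPTIONS --safe #-}

-- The inputs of the first atom of a well typed query are of their types under
-- every substitution; a variable in such a position would force its type to
-- contain all terms. So the first atom is always selectable, hence no atom can
-- be waiting and the leftmost selectable atom is the first one.
-- Resolving the first atom preserves well-typedness, which carries the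
-- argument along the derivation.
module Submission where

open import Defs

open import Level using (Level)
open import Data.Nat.Base using (ℕ; zero; suc; _≤_; z≤n; z<s; s<s; s<s⁻¹; s≤s⁻¹; _⊔_)
open import Data.Nat.Properties using (_≟_; ≤-refl; ≤-trans; n≤1+n; <⇒≢; m≤n⇒m<n∨m≡n; m≤m⊔n; m≤n⊔m)
open import Data.Fin.Base as Fin using (Fin)
open import Data.List.Base as List using ([]; _∷_; _++_)
open import Data.List.Properties using (map-++; map-∘; map-cong)
open import Data.List.Relation.Unary.All as All using (All; []; _∷_)
open import Data.Product.Base using (_×_; _,_; proj₁; proj₂)
open import Data.Sum.Base using (inj₁; inj₂)
open import Data.Unit.Polymorphic.Base using (⊤; tt)
open import Data.Vec.Base as Vec using (Vec; []; _∷_)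
open import Relation.Binary.Construct.Closure.ReflexiveTransitive using (ε; _◅_)
open import Relation.Binary.PropositionalEquality using (_≡_; refl; sym; trans; cong; cong₂; subst; subst₂)
open import Relation.Nullary using (¬_; yes; no; contradiction)

module _ (L : Language) where
  open Logic L

  infixl 7 _⨾_

  -- Typing conditions quantify over all substitutions, so the `σ`-instance of a resolvent under `θ`
  -- can be studied as an instance of the old query and the clause under `θ ⨾ σ`.
  _⨾_ : Substitution → Substitution → Substitution
  apply (θ ⨾ σ) x = apply θ x [ σ ]
  finite-domain (θ ⨾ σ) with finite-domain θ | finite-domain σ
  ... | m , fixθ | n , fixσ = m ⊔ n , λ x m⊔n≤x →
    trans (cong (_[ σ ]) (fixθ x (≤-trans (m≤m⊔n m n) m⊔n≤x)))
          (fixσ x (≤-trans (m≤n⊔m m n) m⊔n≤x))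

  mutual
    []-⨾ : ∀ t θ σ → t [ θ ⨾ σ ] ≡ t [ θ ] [ σ ]
    []-⨾ (var x)    θ σ = refl
    []-⨾ (fun f ts) θ σ = cong (fun f) ([]*-⨾ ts θ σ)

    []*-⨾ : ∀ {n} (ts : Vec Term n) θ σ → ts [ θ ⨾ σ ]* ≡ ts [ θ ]* [ σ ]*
    []*-⨾ []       θ σ = refl
    []*-⨾ (t ∷ ts) θ σ = cong₂ _∷_ ([]-⨾ t θ σ) ([]*-⨾ ts θ σ)

  []ᵃ-⨾ : ∀ a θ σ → a [ θ ⨾ σ ]ᵃ ≡ a [ θ ]ᵃ [ σ ]ᵃ
  []ᵃ-⨾ (atom p ts) θ σ = cong (atom p) ([]*-⨾ ts θ σ)

  []q-⨾ : ∀ Q θ σ → Q [ θ ⨾ σ ]q ≡ Q [ θ ]q [ σ ]q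
  []q-⨾ Q θ σ = trans (map-cong (λ a → []ᵃ-⨾ a θ σ) Q) (map-∘ Q)

  lookup-[]* : ∀ {n} (ts : Vec Term n) k σ → Vec.lookup (ts [ σ ]*) k ≡ Vec.lookup ts k [ σ ]
  lookup-[]* (t ∷ ts) Fin.zero    σ = refl
  lookup-[]* (t ∷ ts) (Fin.suc k) σ = lookup-[]* ts k σ

  _↦_ : Variable → Term → Substitution
  apply (x ↦ t) y with x ≟ y
  ... | yes _ = t
  ... | no _  = var y
  finite-domain (x ↦ t) = suc x , fixed
    where
    fixed : ∀ y → suc x ≤ y → apply (x ↦ t) y ≡ var y
    fixed y x<y with x ≟ y
    ... | yes x≡y = contradiction x≡y (<⇒≢ x<y)
    ... | no _    = refl

  ↦-apply : ∀ x t → var x [ x ↦ t ] ≡ t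
  ↦-apply x t with x ≟ x
  ... | yes _  = refl
  ... | no x≢x = contradiction refl x≢x

  module _ {ℓ : Level} (τ : TypeAssignment ℓ) where

    -- Running through Q from the left, every atom has typed inputs as soon as
    -- the outputs before it are typed, and X holds once all outputs are typed.
    Entails : Query → Set ℓ → Set ℓ
    Entails []      X = X
    Entails (a ∷ Q) X = Typed τ input a × (Typed τ output a → Entails Q X)

    Entails-++ : ∀ Q {R X} → Entails Q (Entails R X) → Entails (Q ++ R) X
    Entails-++ []      e         = e
    Entails-++ (a ∷ Q) (ina , e) = ina , λ out → Entails-++ Q (e out)

    Entails-map : ∀ Q {X Y} → (X → Y) → Entails Q X → Entails Q Y
    Entails-map []      f e         = f e
    Entails-map (a ∷ Q) f (ina , e) = ina , λ out → Entails-map Q f (e out)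

    -- The premises look atoms up in `Q` and instantiate afterwards, as the definitions of
    -- well-typedness do, so no index has to be transported between `Q` and `Q [ σ ]q`.
    entails⁺ : ∀ σ Q {X} →
      (∀ i → (∀ j → j Fin.< i → Typed τ output (List.lookup Q j [ σ ]ᵃ)) →
             Typed τ input (List.lookup Q i [ σ ]ᵃ)) →
      ((∀ j → Typed τ output (List.lookup Q j [ σ ]ᵃ)) → X) →
      Entails (Q [ σ ]q) X
    entails⁺ σ []      inputs final = final λ ()
    entails⁺ σ (a ∷ Q) inputs final =
      inputs Fin.zero (λ _ ()) ,
      λ out → entails⁺ σ Q
        -- The conditions on the tail are those on `a ∷ Q` shifted by one; `out` discharges their
        -- premise about `a`.
        (λ i outs → inputs (Fin.suc i) λ where
          Fin.zero    _   → out
          (Fin.suc j) j<i → outs j (s<s⁻¹ j<i))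
        (λ outs → final λ where
          Fin.zero    → out
          (Fin.suc j) → outs j)

    entails⁻ : ∀ σ Q {X} → Entails (Q [ σ ]q) X →
      ∀ i → (∀ j → j Fin.< i → Typed τ output (List.lookup Q j [ σ ]ᵃ)) →
            Typed τ input (List.lookup Q i [ σ ]ᵃ)
    entails⁻ σ (a ∷ Q) (ina , e) Fin.zero    outs = ina
    entails⁻ σ (a ∷ Q) (ina , e) (Fin.suc i) outs =
      entails⁻ σ Q (e (outs Fin.zero z<s)) i (λ j j<i → outs (Fin.suc j) (s<s j<i))

    wellTypedQuery-entails : ∀ {Q} → WellTypedQuery τ Q → ∀ σ → Entails (Q [ σ ]q) ⊤
    wellTypedQuery-entails {Q} wt σ = entails⁺ σ Q (λ i → wt i σ) (λ _ → tt)

    wellTypedClause-entails : ∀ c → WellTypedClause τ c → ∀ σ →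
      Typed τ input (head c [ σ ]ᵃ) → Entails (body c [ σ ]q) (Typed τ output (head c [ σ ]ᵃ))
    wellTypedClause-entails (h ⟵ B) (wtB , wth) σ inh =
      entails⁺ σ B (λ i → wtB i σ inh) (wth σ inh)

    -- A derivation step resolves with a variant `c [ ρ ]ᶜ` of a program clause `c`; instantiating
    -- it by `σ` amounts to instantiating `c` by `ρ ⨾ σ`.
    instance-entails : ∀ c → WellTypedClause τ c → ∀ ρ σ →
      Typed τ input (head c [ ρ ]ᵃ [ σ ]ᵃ) →
      Entails (body c [ ρ ]q [ σ ]q) (Typed τ output (head c [ ρ ]ᵃ [ σ ]ᵃ))
    instance-entails c wt ρ σ =
      subst₂ (λ h B → Typed τ input h → Entails B (Typed τ output h))
        ([]ᵃ-⨾ (head c) ρ σ) ([]q-⨾ (body c) ρ σ) (wellTypedClause-entails c wt (ρ ⨾ σ))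

    -- Unification identifies `a` with the clause head: the typed inputs of `a` start the body, and
    -- the head outputs that the body then guarantees are the outputs of `a` on which `R` relies.
    resolve-first-wellTyped : ∀ {a R} c ρ θ →
      WellTypedQuery τ (a ∷ R) → WellTypedClause τ c →
      Unifier a (head c [ ρ ]ᵃ) θ → WellTypedQuery τ ((body c [ ρ ]q ++ R) [ θ ]q)
    resolve-first-wellTyped {a} {R} c@(h ⟵ B) ρ θ wtQ wtC unifies i σ =
      entails⁻ σ ((B [ ρ ]q ++ R) [ θ ]q) resolvent i
      where
      a≡h : a [ θ ⨾ σ ]ᵃ ≡ h [ ρ ]ᵃ [ θ ⨾ σ ]ᵃ
      a≡h = trans ([]ᵃ-⨾ a θ σ)
              (trans (cong (_[ σ ]ᵃ) unifies) (sym ([]ᵃ-⨾ (h [ ρ ]ᵃ) θ σ)))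

      query : Entails ((a ∷ R) [ θ ⨾ σ ]q) ⊤
      query = wellTypedQuery-entails {a ∷ R} wtQ (θ ⨾ σ)

      body-then-right : Entails (B [ ρ ]q [ θ ⨾ σ ]q) (Entails (R [ θ ⨾ σ ]q) ⊤)
      body-then-right = Entails-map (B [ ρ ]q [ θ ⨾ σ ]q)
        (λ outh → proj₂ query (subst (Typed τ output) (sym a≡h) outh))
        (instance-entails c wtC ρ (θ ⨾ σ) (subst (Typed τ input) a≡h (proj₁ query)))

      resolvent : Entails ((B [ ρ ]q ++ R) [ θ ]q [ σ ]q) ⊤
      resolvent = subst (λ Q → Entails Q ⊤)
        (trans (sym (map-++ (_[ θ ⨾ σ ]ᵃ) (B [ ρ ]q) R)) ([]q-⨾ (B [ ρ ]q ++ R) θ σ))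
        (Entails-++ (B [ ρ ]q [ θ ⨾ σ ]q) body-then-right)

    first-nonVariableInputsFilled : ∀ {a R} → WellTypedQuery τ (a ∷ R) → NonVariableInputsFilled τ a
    first-nonVariableInputsFilled {a} wt k isInput nonVar (x , argk≡x) = nonVar λ t →
      subst (_∶ τ (pred a) k)
        (trans (lookup-[]* (args a) k (x ↦ t)) (trans (cong (_[ x ↦ t ]) argk≡x) (↦-apply x t)))
        -- No atom precedes the first one, so its typing condition has a vacuous premise and applies
        -- to `x ↦ t` for arbitrary `t`.
        (wt Fin.zero (x ↦ t) (λ _ ()) k isInput)

    module _ (P : Program) (wtP : WellTypedProgram τ P)
             (filled⇒selectable : ∀ a → NonVariableInputsFilled τ a → Selectable P a) where

      -- This serves two prefixes: the one that makes its descendants waiting, and the atoms left of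
      -- the leftmost selectable one.
      unselectable-prefix-empty : ∀ R₁ {R₂} → WellTypedQuery τ (R₁ ++ R₂) →
        All (λ a → ¬ Selectable P a) R₁ → R₁ ≡ []
      unselectable-prefix-empty []       wt _           = refl
      unselectable-prefix-empty (a ∷ R₁) wt (unsel ∷ _) =
        contradiction (filled⇒selectable a (first-nonVariableInputsFilled wt)) unsel

      step-first-wellTyped : ∀ {Q Q′} (s : Step P Q Q′) → Step.left s ≡ [] →
        WellTypedQuery τ Q → WellTypedQuery τ Q′
      step-first-wellTyped
        record { query-≡ = refl ; source = c ; source-∈ = c∈P ; variant = (ρ , refl) , _
               ; θ = θ ; mgu = unifies , _ ; result-≡ = refl } refl wt =
        resolve-first-wellTyped c ρ θ wt (All.lookup wtP c∈P) unifies

      module _ {Q : Query} (wtQ : WellTypedQuery τ Q) (D : Derivation P Q)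
               (leftBased : LeftBased P D) where
        open Derivation D

        <ˡ-pred : ∀ {i} n → suc i <ˡ n → i <ˡ n
        <ˡ-pred (finite n) i<n = ≤-trans (n≤1+n _) i<n
        <ˡ-pred ω          _   = _

        descendant-≤ : ∀ {j l i k} → Descendant P D (j , l) (i , k) → j ≤ i
        descendant-≤ ε                = ≤-refl
        descendant-≤ (direct _ _ ◅ d) = ≤-trans (n≤1+n _) (descendant-≤ d)

        -- An atom waiting in query `i` may owe this to any query `j` with `j ≤ i`, so the invariant
        -- has to cover the whole history.
        WellTypedUpTo : ℕ → Set ℓ
        WellTypedUpTo i = ∀ {j} → j ≤ i → WellTypedQuery τ (query j)

        not-waiting : ∀ {i k} → WellTypedUpTo i → ¬ Waiting P D i k
        not-waiting wt (j , R₁ , R₂ , eq , unsel , l , l<R₁ , desc)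
          -- The prefix that would cause the waiting is empty, so it has no position `l` to descend
          -- from.
          with refl ← unselectable-prefix-empty R₁ (subst (WellTypedQuery τ) eq (wt (descendant-≤ desc))) unsel
          with () ← l<R₁

        selects-first : ∀ i i< → WellTypedUpTo i → Step.left (step i i<) ≡ []
        selects-first i i< wt with proj₂ leftBased i i<
        ... | inj₁ waiting     = contradiction waiting (not-waiting wt)
        ... | inj₂ (_ , unsel) = unselectable-prefix-empty _
              (subst (WellTypedQuery τ) (Step.query-≡ (step i i<)) (wt ≤-refl)) unsel

        wellTypedUpTo : ∀ i → i <ˡ steps → WellTypedUpTo i
        wellTypedUpTo zero    _  z≤n = subst (WellTypedQuery τ) (sym start) wtQ
        wellTypedUpTo (suc i) i< j≤1+i with m≤n⇒m<n∨m≡n j≤1+i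
        ... | inj₁ j<1+i = wellTypedUpTo i (<ˡ-pred steps i<) (s≤s⁻¹ j<1+i)
        -- The induction interleaves two facts: the invariant up to `i` forces step `i` to resolve
        -- the first atom, and such a step keeps the next query well typed.
        ... | inj₂ refl  = step-first-wellTyped (step i i<′) (selects-first i i<′ wt) (wt ≤-refl)
          where
          i<′ : i <ˡ steps
          i<′ = <ˡ-pred steps i<

          wt : WellTypedUpTo i
          wt = wellTypedUpTo i i<′

        leftBased⇒LD : LDDerivation P D
        leftBased⇒LD i i< = selects-first i i< (wellTypedUpTo i i<)

proposition4p2 : ∀ {ℓ} (L : Language) → let open Logic L in
    (τ : TypeAssignment ℓ) (P : Program) (Q : Query) →
    WellTypedQuery τ Q →
    WellTypedProgram τ P →
    (∀ a → NonVariableInputsFilled τ a → Selectable P a) →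
    (D : Derivation P Q) → LeftBased P D → LDDerivation P D
proposition4p2 L τ P Q wtQ wtP filled⇒selectable =
  leftBased⇒LD L τ P wtP filled⇒selectable wtQ
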